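{- Let $\mathcal A\subseteq\mathbb N$, $L$ an environment and $T$ a term. If $L\vdash_{\mathcal A}T$, then there exists a term $U$ such that $L\vdash_{\mathcal A}T:U$.
   Context: Fix a nonempty set $\Sigma$ of sorts with decidable equality, an arbitrary function $\mathrm{next}:\Sigma\to\Sigma$, and a countably infinite set of variables. Terms and environments: $T,U,V,W ::= \star s \mid x \mid \mathrm{app}(V,T) \mid \lambda x{:}W.\,T \mid \mathrm{def}(x{=}V).\,T \mid \mathrm{cast}(U,T)$ ($s\in\Sigma$) and $L,K ::= \emptyset \mid K,x{:}W \mid K,x{=}V$. $\mathrm{app}(V,T)$ applies $T$ to $V$; $\lambda x{:}W.\,T$ (de Bruijn's abstraction) and $\mathrm{def}(x{=}V).\,T$ (local definition) bind $x$ in $T$; $\mathrm{cast}(U,T)$ annotates $T$ with expected type $U$; entries $x{:}W$ and $x{=}V$ bind $x$. Terms are modulo renaming of bound variables. Write $\mathsf{B}x[V]$ for either $\lambda x{:}V$ or $\mathrm{def}(x{=}V)$ and correspondingly $L,x[V]$ for $L,x{:}V$ resp. $L,x{=}V$. One step of bound rt-reduction $L\vdash T_1\to^nT_2$ is the smallest relation closed under: $L\vdash\mathrm{app}(V,\lambda x{:}W.\,T)\to^0\mathrm{def}(x{=}\mathrm{cast}(W,V)).\,T$; $K,x{=}V\vdash x\to^0V$; $L\vdash\mathrm{def}(x{=}V).\,T\to^0T$ if $x$ not free in $T$; $L\vdash\mathrm{app}(V,\mathrm{def}(x{=}W).\,T)\to^0\mathrm{def}(x{=}W).\,\mathrm{app}(V,T)$;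 $L\vdash\mathrm{cast}(U,T)\to^0T$; $L\vdash\star s\to^1\star\,\mathrm{next}(s)$; $K,x{:}W\vdash x\to^1W$; $L\vdash\mathrm{cast}(U,T)\to^1U$; if $K\vdash x\to^nT$, $y\neq x$, $y$ not free in $T$ then $K,y[V]\vdash x\to^nT$; if $L\vdash V_1\to^0V_2$ then $L\vdash\mathrm{app}(V_1,T)\to^0\mathrm{app}(V_2,T)$; if $L\vdash T_1\to^nT_2$ then $L\vdash\mathrm{app}(V,T_1)\to^n\mathrm{app}(V,T_2)$; if $L\vdash V_1\to^0V_2$ then $L\vdash\mathsf Bx[V_1].\,T\to^0\mathsf Bx[V_2].\,T$; if $L,x[V]\vdash T_1\to^nT_2$ then $L\vdash\mathsf Bx[V].\,T_1\to^n\mathsf Bx[V].\,T_2$; if $L\vdash U_1\to^0U_2$ then $L\vdash\mathrm{cast}(U_1,T)\to^0\mathrm{cast}(U_2,T)$; if $L\vdash T_1\to^0T_2$ then $L\vdash\mathrm{cast}(U,T_1)\to^0\mathrm{cast}(U,T_2)$; if $L\vdash U_1\to^1U_2$ and $L\vdash T_1\to^1T_2$ then $L\vdash\mathrm{cast}(U_1,T_1)\to^1\mathrm{cast}(U_2,T_2)$. $L\vdash T_1\to^{*n}T_2$ is the smallest relation with $L\vdash T\to^{*0}T$, containing single steps, and with $L\vdash T_1\to^{*n_1}T$, $L\vdash T\to^{*n_2}T_2$ implying $L\vdash T_1\to^{*n_1+n_2}T_2$. Validity $L\vdash_{\mathcal A}T$ is the smallest predicate closed under: $L\vdash_{\mathcal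 A}\star s$; if $K\vdash_{\mathcal A}V$ then $K,x[V]\vdash_{\mathcal A}x$; if $K\vdash_{\mathcal A}x$ and $y\neq x$ then $K,y[V]\vdash_{\mathcal A}x$; if $L\vdash_{\mathcal A}V$ and $L,x[V]\vdash_{\mathcal A}T$ then $L\vdash_{\mathcal A}\mathsf Bx[V].\,T$; if $L\vdash_{\mathcal A}U$, $L\vdash_{\mathcal A}T$ and some $U_0$ satisfies $L\vdash T\to^{*1}U_0$, $L\vdash U\to^{*0}U_0$, then $L\vdash_{\mathcal A}\mathrm{cast}(U,T)$; if $L\vdash_{\mathcal A}V$, $L\vdash_{\mathcal A}T$ and there are $n\in\mathcal A$, $x,W_0,U_0$ with $L\vdash T\to^{*n}\lambda x{:}W_0.\,U_0$ and $L\vdash V\to^{*1}W_0$, then $L\vdash_{\mathcal A}\mathrm{app}(V,T)$. The type judgment $L\vdash_{\mathcal A}T:U$ means $L\vdash_{\mathcal A}\mathrm{cast}(U,T)$. -}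

module Defs where

-- Terms and environments of the calculus, with bound variables represented
-- by de Bruijn indices (this realises "terms modulo renaming of bound
-- variables").  The set of sorts is a parameter S of the datatypes; the
-- function next : S → S is a parameter of the reduction relation.

open import Data.Nat using (ℕ; zero; suc; _+_; _<?_)
open import Data.Product using (Σ; ∃; _×_; _,_)
open import Relation.Nullary using (yes; no)

data Binder : Set where
  abst abbr : Binder

data Term (S : Set) : Set where
  sort : S → Term S
  var  : ℕ → Term S
  app  : Term S → Term S → Term S            -- app(V,T): T applied to V
  bind : Binder → Term S → Term S → Term S
  cast : Term S → Term S → Term S

lam : ∀ {S} → Term S → Term S → Term S
lam = bind abst

def : ∀ {S} → Term S → Term S → Term S
def = bind abbr

-- environments; the last entry is the innermost (index 0)
data Env (S : Set) : Set where
  ⋆   : Env S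
  _,[_]_ : Env S → Binder → Term S → Env S

shift : ∀ {S} → ℕ → Term S → Term S
shift c (sort s)     = sort s
shift c (var i) with i <? c
... | yes _ = var i
... | no  _ = var (suc i)
shift c (app V T)    = app (shift c V) (shift c T)
shift c (bind b V T) = bind b (shift c V) (shift (suc c) T)
shift c (cast U T)   = cast (shift c U) (shift c T)

lift : ∀ {S} → Term S → Term S
lift = shift 0

module _ {S : Set} (next : S → S) where

  data _⊢_⟶[_]_ : Env S → Term S → ℕ → Term S → Set where
    beta   : ∀ {L V W T} → L ⊢ app V (lam W T) ⟶[ 0 ] def (cast W V) T
    delta  : ∀ {K V} → (K ,[ abbr ] V) ⊢ var 0 ⟶[ 0 ] lift V
    zeta   : ∀ {L V T} → L ⊢ def V (lift T) ⟶[ 0 ] T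
    theta  : ∀ {L V W T} → L ⊢ app V (def W T) ⟶[ 0 ] def W (app (lift V) T)
    epsilon : ∀ {L U T} → L ⊢ cast U T ⟶[ 0 ] T
    sortS  : ∀ {L s} → L ⊢ sort s ⟶[ 1 ] sort (next s)
    ldelta : ∀ {K W} → (K ,[ abst ] W) ⊢ var 0 ⟶[ 1 ] lift W
    ee     : ∀ {L U T} → L ⊢ cast U T ⟶[ 1 ] U
    lref   : ∀ {K i n T b V} → K ⊢ var i ⟶[ n ] T →
             (K ,[ b ] V) ⊢ var (suc i) ⟶[ n ] lift T
    appL   : ∀ {L V₁ V₂ T} → L ⊢ V₁ ⟶[ 0 ] V₂ → L ⊢ app V₁ T ⟶[ 0 ] app V₂ T
    appR   : ∀ {L V T₁ T₂ n} → L ⊢ T₁ ⟶[ n ] T₂ → L ⊢ app V T₁ ⟶[ n ] app V T₂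
    bindL  : ∀ {L b V₁ V₂ T} → L ⊢ V₁ ⟶[ 0 ] V₂ → L ⊢ bind b V₁ T ⟶[ 0 ] bind b V₂ T
    bindR  : ∀ {L b V T₁ T₂ n} → (L ,[ b ] V) ⊢ T₁ ⟶[ n ] T₂ →
             L ⊢ bind b V T₁ ⟶[ n ] bind b V T₂
    castL  : ∀ {L U₁ U₂ T} → L ⊢ U₁ ⟶[ 0 ] U₂ → L ⊢ cast U₁ T ⟶[ 0 ] cast U₂ T
    castR  : ∀ {L U T₁ T₂} → L ⊢ T₁ ⟶[ 0 ] T₂ → L ⊢ cast U T₁ ⟶[ 0 ] cast U T₂
    castB  : ∀ {L U₁ U₂ T₁ T₂} → L ⊢ U₁ ⟶[ 1 ] U₂ → L ⊢ T₁ ⟶[ 1 ] T₂ →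
             L ⊢ cast U₁ T₁ ⟶[ 1 ] cast U₂ T₂

  data _⊢_⟶*[_]_ : Env S → Term S → ℕ → Term S → Set where
    refl* : ∀ {L T} → L ⊢ T ⟶*[ 0 ] T
    step* : ∀ {L T₁ T₂ n} → L ⊢ T₁ ⟶[ n ] T₂ → L ⊢ T₁ ⟶*[ n ] T₂
    trans* : ∀ {L T₁ T T₂ n₁ n₂} → L ⊢ T₁ ⟶*[ n₁ ] T → L ⊢ T ⟶*[ n₂ ] T₂ →
             L ⊢ T₁ ⟶*[ n₁ + n₂ ] T₂

  data Valid (𝒜 : ℕ → Set) : Env S → Term S → Set where
    v-sort : ∀ {L s} → Valid 𝒜 L (sort s)
    v-zero : ∀ {K b V} → Valid 𝒜 K V → Valid 𝒜 (K ,[ b ] V) (var 0)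
    v-lref : ∀ {K b V i} → Valid 𝒜 K (var i) → Valid 𝒜 (K ,[ b ] V) (var (suc i))
    v-bind : ∀ {L b V T} → Valid 𝒜 L V → Valid 𝒜 (L ,[ b ] V) T →
             Valid 𝒜 L (bind b V T)
    v-cast : ∀ {L U T} → Valid 𝒜 L U → Valid 𝒜 L T →
             (Σ (Term S) λ U₀ → (L ⊢ T ⟶*[ 1 ] U₀) × (L ⊢ U ⟶*[ 0 ] U₀)) →
             Valid 𝒜 L (cast U T)
    v-app  : ∀ {L V T} → Valid 𝒜 L V → Valid 𝒜 L T →
             (Σ ℕ λ n → 𝒜 n × Σ (Term S) λ W₀ → Σ (Term S) λ U₀ →
                (L ⊢ T ⟶*[ n ] lam W₀ U₀) × (L ⊢ V ⟶*[ 1 ] W₀)) →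
             Valid 𝒜 L (app V T)

  Typed : (ℕ → Set) → Env S → Term S → Term S → Set
  Typed 𝒜 L T U = Valid 𝒜 L (cast U T)

{-# OPTIONS --safe #-}

module Submission where

-- Valid terms are interpreted, by erasing casts and unfolding definitions, in a calculus
-- whose β-step is admitted only if the type of the argument is convertible to the expected
-- one, conversion being generated by these very steps.  This checked reduction is confluent
-- without any appeal to normalisation, and both it and the type assignment tp respect
-- conversion.  Hence bound reduction with n t-steps acts on the interpretations as tp^ n up to
-- conversion, and the side conditions of validity become preserved.  The type of app(V,T) is
-- app(V,U) with U the type of T: if T reduces in n steps to λx:W.T′, then the n-th iterated
-- type of U is convertible to the type of λx:W.T′, so by confluence U itself reduces in n
-- steps to an abstraction over a reduct of W.  Erased reductions and tp are simulated back
-- in the original calculus, because casts and definitions can always be removed by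
-- ε, δ and ζ.

open import Defs
open import Data.Nat using (ℕ; zero; suc; _+_; _<?_; s≤s)
open import Data.Nat.Properties using (+-comm; +-identityʳ; m+n≡0⇒m≡0; m+n≡0⇒n≡0)
open import Data.Product using (Σ; ∃; _×_; _,_; proj₁; proj₂)
open import Data.Empty using (⊥)
open import Data.Unit using (⊤; tt)
open import Function using (_∘_; id)
open import Relation.Binary.Definitions using (DecidableEquality)
open import Relation.Binary.PropositionalEquality
  using (_≡_; refl; sym; trans; cong; cong₂; subst; subst₂)
open import Relation.Nullary using (yes; no; contradiction)

-- Renaming and substitution on erased terms.

infixr 5 _∷ₛ_

_∷ₛ_ : ∀ {a} {A : Set a} → A → (ℕ → A) → ℕ → A
(a ∷ₛ f) zero    = a
(a ∷ₛ f) (suc x) = f x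

⇑ᵣ : (ℕ → ℕ) → ℕ → ℕ
⇑ᵣ ρ = zero ∷ₛ (suc ∘ ρ)

-- The cast-free and definition-free terms into which the calculus is interpreted.
data Tm (S : Set) : Set where
  srt : S → Tm S
  ref : ℕ → Tm S
  apl : Tm S → Tm S → Tm S
  abs : Tm S → Tm S → Tm S

module _ {S : Set} where

  ren : (ℕ → ℕ) → Tm S → Tm S
  ren ρ (srt s)   = srt s
  ren ρ (ref x)   = ref (ρ x)
  ren ρ (apl V T) = apl (ren ρ V) (ren ρ T)
  ren ρ (abs W T) = abs (ren ρ W) (ren (⇑ᵣ ρ) T)

  wk : Tm S → Tm S
  wk = ren suc

  ⇑ : (ℕ → Tm S) → ℕ → Tm S
  ⇑ σ = ref zero ∷ₛ (wk ∘ σ)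

  sub : (ℕ → Tm S) → Tm S → Tm S
  sub σ (srt s)   = srt s
  sub σ (ref x)   = σ x
  sub σ (apl V T) = apl (sub σ V) (sub σ T)
  sub σ (abs W T) = abs (sub σ W) (sub (⇑ σ) T)

  _[_] : Tm S → Tm S → Tm S
  T [ V ] = sub (V ∷ₛ ref) T

  ren-ren : ∀ {ρ₁ ρ₂ ρ₃} → (∀ x → ρ₂ (ρ₁ x) ≡ ρ₃ x) → ∀ T → ren ρ₂ (ren ρ₁ T) ≡ ren ρ₃ T
  ren-ren e (srt s)   = refl
  ren-ren e (ref x)   = cong ref (e x)
  ren-ren e (apl V T) = cong₂ apl (ren-ren e V) (ren-ren e T)
  ren-ren e (abs W T) =
    cong₂ abs (ren-ren e W) (ren-ren (λ { zero → refl ; (suc x) → cong suc (e x) }) T)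

  wk-ren : ∀ ρ T → ren (⇑ᵣ ρ) (wk T) ≡ wk (ren ρ T)
  wk-ren ρ T = trans (ren-ren (λ _ → refl) T) (sym (ren-ren (λ _ → refl) T))

  sub-id : ∀ {σ} → (∀ x → σ x ≡ ref x) → ∀ T → sub σ T ≡ T
  sub-id e (srt s)   = refl
  sub-id e (ref x)   = e x
  sub-id e (apl V T) = cong₂ apl (sub-id e V) (sub-id e T)
  sub-id e (abs W T) =
    cong₂ abs (sub-id e W) (sub-id (λ { zero → refl ; (suc x) → cong wk (e x) }) T)

  sub-ren : ∀ {ρ σ σ′} → (∀ x → σ (ρ x) ≡ σ′ x) → ∀ T → sub σ (ren ρ T) ≡ sub σ′ T
  sub-ren e (srt s)   = refl
  sub-ren e (ref x)   = e x
  sub-ren e (apl V T) = cong₂ apl (sub-ren e V) (sub-ren e T)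
  sub-ren e (abs W T) =
    cong₂ abs (sub-ren e W) (sub-ren (λ { zero → refl ; (suc x) → cong wk (e x) }) T)

  ren-sub : ∀ {ρ σ σ′} → (∀ x → ren ρ (σ x) ≡ σ′ x) → ∀ T → ren ρ (sub σ T) ≡ sub σ′ T
  ren-sub e (srt s)   = refl
  ren-sub e (ref x)   = e x
  ren-sub e (apl V T) = cong₂ apl (ren-sub e V) (ren-sub e T)
  ren-sub {ρ} {σ} e (abs W T) =
    cong₂ abs (ren-sub e W)
      (ren-sub (λ { zero → refl ; (suc x) → trans (wk-ren ρ (σ x)) (cong wk (e x)) }) T)

  wk-sub : ∀ σ T → sub (⇑ σ) (wk T) ≡ wk (sub σ T)
  wk-sub σ T = trans (sub-ren (λ _ → refl) T) (sym (ren-sub (λ _ → refl) T))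

  sub-sub : ∀ {σ τ σ′} → (∀ x → sub τ (σ x) ≡ σ′ x) → ∀ T → sub τ (sub σ T) ≡ sub σ′ T
  sub-sub e (srt s)   = refl
  sub-sub e (ref x)   = e x
  sub-sub e (apl V T) = cong₂ apl (sub-sub e V) (sub-sub e T)
  sub-sub {σ} {τ} e (abs W T) =
    cong₂ abs (sub-sub e W)
      (sub-sub (λ { zero → refl ; (suc x) → trans (wk-sub τ (σ x)) (cong wk (e x)) }) T)

  ren≡sub : ∀ ρ T → ren ρ T ≡ sub (ref ∘ ρ) T
  ren≡sub ρ T = trans (cong (ren ρ) (sym (sub-id (λ _ → refl) T))) (ren-sub (λ _ → refl) T)

  wk-[] : ∀ T V → (wk T) [ V ] ≡ T
  wk-[] T V = trans (sub-ren (λ _ → refl) T) (sub-id (λ _ → refl) T)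

  ren-[] : ∀ ρ T V → ren (⇑ᵣ ρ) T [ ren ρ V ] ≡ ren ρ (T [ V ])
  ren-[] ρ T V =
    trans (sub-ren {σ′ = ren ρ V ∷ₛ (ref ∘ ρ)} (λ { zero → refl ; (suc x) → refl }) T)
          (sym (ren-sub (λ { zero → refl ; (suc x) → refl }) T))

  sub-[] : ∀ σ T V → sub (⇑ σ) T [ sub σ V ] ≡ sub σ (T [ V ])
  sub-[] σ T V =
    trans (sub-sub {σ′ = sub σ V ∷ₛ σ} (λ { zero → refl ; (suc x) → wk-[] (σ x) _ }) T)
          (sym (sub-sub (λ { zero → refl ; (suc x) → refl }) T))

-- Type assignment, checked reduction and conversion.

module Conversion {S : Set} (next : S → S) where

  -- A context assigns to each variable its type, already weakened to the whole context.
  Ctx : Set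
  Ctx = ℕ → Tm S

  infixl 5 _▷_

  _▷_ : Ctx → Tm S → Ctx
  Γ ▷ W = wk W ∷ₛ (wk ∘ Γ)

  -- No redex is contracted and no domain is compared with an argument, so this is a total
  -- structural recursion on all terms, well typed or not.
  tp : Ctx → Tm S → Tm S
  tp Γ (srt s)   = srt (next s)
  tp Γ (ref x)   = Γ x
  tp Γ (apl V T) = apl V (tp Γ T)
  tp Γ (abs W T) = abs W (tp (Γ ▷ W) T)

  tp^ : ℕ → Ctx → Tm S → Tm S
  tp^ zero    Γ T = T
  tp^ (suc n) Γ T = tp Γ (tp^ n Γ T)

  infix 4 _⊢_⇒_ _⊢_≅_ _⊢_⇒*_

  -- Contracting a redex requires the argument to have the expected type.  Without this
  -- condition the contraction would not commute with tp.
  data _⊢_⇒_ : Ctx → Tm S → Tm S → Set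
  data _⊢_≅_ (Γ : Ctx) : Tm S → Tm S → Set

  data _⊢_⇒_ where
    ⇒srt : ∀ {Γ s} → Γ ⊢ srt s ⇒ srt s
    ⇒ref : ∀ {Γ x} → Γ ⊢ ref x ⇒ ref x
    ⇒apl : ∀ {Γ V V′ T T′} → Γ ⊢ V ⇒ V′ → Γ ⊢ T ⇒ T′ → Γ ⊢ apl V T ⇒ apl V′ T′
    ⇒abs : ∀ {Γ W W′ T T′} → Γ ⊢ W ⇒ W′ → Γ ▷ W ⊢ T ⇒ T′ → Γ ⊢ abs W T ⇒ abs W′ T′
    ⇒β   : ∀ {Γ V V′ W T T′} → Γ ⊢ V ⇒ V′ → Γ ▷ W ⊢ T ⇒ T′ → Γ ⊢ tp Γ V ≅ W →
           Γ ⊢ apl V (abs W T) ⇒ T′ [ V′ ]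

  data _⊢_≅_ Γ where
    ≅step  : ∀ {T T′} → Γ ⊢ T ⇒ T′ → Γ ⊢ T ≅ T′
    ≅refl  : ∀ {T} → Γ ⊢ T ≅ T
    ≅sym   : ∀ {T T′} → Γ ⊢ T ≅ T′ → Γ ⊢ T′ ≅ T
    ≅trans : ∀ {T T′ T″} → Γ ⊢ T ≅ T′ → Γ ⊢ T′ ≅ T″ → Γ ⊢ T ≅ T″

  ≅reflexive : ∀ {Γ T T′} → T ≡ T′ → Γ ⊢ T ≅ T′
  ≅reflexive refl = ≅refl

  ⇒refl : ∀ {Γ} T → Γ ⊢ T ⇒ T
  ⇒refl (srt s)   = ⇒srt
  ⇒refl (ref x)   = ⇒ref
  ⇒refl (apl V T) = ⇒apl (⇒refl V) (⇒refl T)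
  ⇒refl (abs W T) = ⇒abs (⇒refl W) (⇒refl T)

  ≅map : ∀ {Γ Δ} {f : Tm S → Tm S} → (∀ {T T′} → Γ ⊢ T ⇒ T′ → Δ ⊢ f T ⇒ f T′) →
         ∀ {T T′} → Γ ⊢ T ≅ T′ → Δ ⊢ f T ≅ f T′
  ≅map h (≅step p)    = ≅step (h p)
  ≅map h ≅refl        = ≅refl
  ≅map h (≅sym c)     = ≅sym (≅map h c)
  ≅map h (≅trans c d) = ≅trans (≅map h c) (≅map h d)

  ≅apl : ∀ {Γ V V′ T T′} → Γ ⊢ V ≅ V′ → Γ ⊢ T ≅ T′ → Γ ⊢ apl V T ≅ apl V′ T′
  ≅apl c d = ≅trans (≅map (λ p → ⇒apl p (⇒refl _)) c) (≅map (⇒apl (⇒refl _)) d)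

  ≅abs : ∀ {Γ W W′ T T′} → Γ ⊢ W ≅ W′ → Γ ▷ W ⊢ T ≅ T′ → Γ ⊢ abs W T ≅ abs W′ T′
  ≅abs c d = ≅trans (≅map (⇒abs (⇒refl _)) d) (≅map (λ p → ⇒abs p (⇒refl _)) c)

  record IsRen (ρ : ℕ → ℕ) (Γ Δ : Ctx) : Set where
    field at : ∀ x → Δ (ρ x) ≡ ren ρ (Γ x)
  open IsRen

  IsRen-⇑ : ∀ {ρ Γ Δ} → IsRen ρ Γ Δ → ∀ W → IsRen (⇑ᵣ ρ) (Γ ▷ W) (Δ ▷ ren ρ W)
  IsRen-⇑ h W .at zero = sym (wk-ren _ W)
  IsRen-⇑ {Γ = Γ} h W .at (suc x) = trans (cong wk (h .at x)) (sym (wk-ren _ (Γ x)))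

  IsRen-wk : ∀ {Γ W} → IsRen suc Γ (Γ ▷ W)
  IsRen-wk .at x = refl

  tp-ren : ∀ {ρ Γ Δ} → IsRen ρ Γ Δ → ∀ T → tp Δ (ren ρ T) ≡ ren ρ (tp Γ T)
  tp-ren h (srt s)   = refl
  tp-ren h (ref x)   = h .at x
  tp-ren h (apl V T) = cong (apl _) (tp-ren h T)
  tp-ren h (abs W T) = cong (abs _) (tp-ren (IsRen-⇑ h W) T)

  ⇒ren : ∀ {ρ Γ Δ T T′} → IsRen ρ Γ Δ → Γ ⊢ T ⇒ T′ → Δ ⊢ ren ρ T ⇒ ren ρ T′
  ≅ren : ∀ {ρ Γ Δ T T′} → IsRen ρ Γ Δ → Γ ⊢ T ≅ T′ → Δ ⊢ ren ρ T ≅ ren ρ T′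

  ⇒ren h ⇒srt       = ⇒srt
  ⇒ren h ⇒ref       = ⇒ref
  ⇒ren h (⇒apl p q) = ⇒apl (⇒ren h p) (⇒ren h q)
  ⇒ren h (⇒abs p q) = ⇒abs (⇒ren h p) (⇒ren (IsRen-⇑ h _) q)
  ⇒ren {ρ} {Δ = Δ} h (⇒β {V = V} {V′} {W} {T} {T′} p q c) =
    subst (Δ ⊢ _ ⇒_) (ren-[] ρ T′ V′)
      (⇒β (⇒ren h p) (⇒ren (IsRen-⇑ h _) q)
          (subst (Δ ⊢_≅ _) (sym (tp-ren h V)) (≅ren h c)))

  ≅ren h (≅step p)    = ≅step (⇒ren h p)
  ≅ren h ≅refl        = ≅refl
  ≅ren h (≅sym c)     = ≅sym (≅ren h c)
  ≅ren h (≅trans c d) = ≅trans (≅ren h c) (≅ren h d)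

  ≅wk : ∀ {Γ W T T′} → Γ ⊢ T ≅ T′ → Γ ▷ W ⊢ wk T ≅ wk T′
  ≅wk = ≅ren IsRen-wk

  -- Respecting types only up to conversion lets one notion cover both the substitution of a checked
  -- argument (`IsSub-∷`) and the exchange of a context entry for a convertible one (`IsSub-▷`).
  record IsSub (σ : ℕ → Tm S) (Γ Δ : Ctx) : Set where
    field at : ∀ x → Δ ⊢ tp Δ (σ x) ≅ sub σ (Γ x)
  open IsSub

  IsSub-⇑≅ : ∀ {σ Γ Δ W W′} → IsSub σ Γ Δ → Δ ⊢ W′ ≅ sub σ W → IsSub (⇑ σ) (Γ ▷ W) (Δ ▷ W′)
  IsSub-⇑≅ {σ} {W = W} h c .at zero = ≅trans (≅wk c) (≅reflexive (sym (wk-sub σ W)))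
  IsSub-⇑≅ {σ} {Γ} h c .at (suc x) =
    ≅trans (≅reflexive (tp-ren IsRen-wk (σ x)))
      (≅trans (≅wk (h .at x)) (≅reflexive (sym (wk-sub σ (Γ x)))))

  IsSub-⇑ : ∀ {σ Γ Δ} → IsSub σ Γ Δ → ∀ W → IsSub (⇑ σ) (Γ ▷ W) (Δ ▷ sub σ W)
  IsSub-⇑ h W = IsSub-⇑≅ h ≅refl

  IsSub-∷ : ∀ {Γ V W} → Γ ⊢ tp Γ V ≅ W → IsSub (V ∷ₛ ref) (Γ ▷ W) Γ
  IsSub-∷ {W = W} c .at zero = ≅trans c (≅reflexive (sym (wk-[] W _)))
  IsSub-∷ {Γ} c .at (suc x) = ≅reflexive (sym (wk-[] (Γ x) _))

  IsSub-▷ : ∀ {Γ W W′} → Γ ⊢ W ≅ W′ → IsSub ref (Γ ▷ W) (Γ ▷ W′)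
  IsSub-▷ c .at zero = ≅trans (≅wk (≅sym c)) (≅reflexive (sym (sub-id (λ _ → refl) _)))
  IsSub-▷ c .at (suc x) = ≅reflexive (sym (sub-id (λ _ → refl) _))

  tp-sub : ∀ {σ Γ Δ} → IsSub σ Γ Δ → ∀ T → Δ ⊢ tp Δ (sub σ T) ≅ sub σ (tp Γ T)
  tp-sub h (srt s)   = ≅refl
  tp-sub h (ref x)   = h .at x
  tp-sub h (apl V T) = ≅apl ≅refl (tp-sub h T)
  tp-sub h (abs W T) = ≅abs ≅refl (tp-sub (IsSub-⇑ h W) T)

  ⇒⇑ : ∀ {σ σ′ Δ W} → (∀ x → Δ ⊢ σ x ⇒ σ′ x) → ∀ x → Δ ▷ W ⊢ ⇑ σ x ⇒ ⇑ σ′ x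
  ⇒⇑ e zero    = ⇒ref
  ⇒⇑ e (suc x) = ⇒ren IsRen-wk (e x)

  ⇒sub : ∀ {σ σ′ Γ Δ T T′} → IsSub σ Γ Δ → (∀ x → Δ ⊢ σ x ⇒ σ′ x) →
         Γ ⊢ T ⇒ T′ → Δ ⊢ sub σ T ⇒ sub σ′ T′
  ≅sub : ∀ {σ Γ Δ T T′} → IsSub σ Γ Δ → Γ ⊢ T ≅ T′ → Δ ⊢ sub σ T ≅ sub σ T′

  ⇒sub h e ⇒srt       = ⇒srt
  ⇒sub h e ⇒ref       = e _
  ⇒sub h e (⇒apl p q) = ⇒apl (⇒sub h e p) (⇒sub h e q)
  ⇒sub h e (⇒abs p q) = ⇒abs (⇒sub h e p) (⇒sub (IsSub-⇑ h _) (⇒⇑ e) q)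
  ⇒sub {σ′ = σ′} {Δ = Δ} h e (⇒β {V = V} {V′} {W} {T} {T′} p q c) =
    subst (Δ ⊢ _ ⇒_) (sub-[] σ′ T′ V′)
      -- The check survives because `tp-sub` makes the type of `sub σ V` convertible to the
      -- substituted type of `V`. Since `c` is a subderivation, the call of `≅sub` is structural.
      (⇒β (⇒sub h e p) (⇒sub (IsSub-⇑ h _) (⇒⇑ e) q) (≅trans (tp-sub h V) (≅sub h c)))

  ≅sub h (≅step p)    = ≅step (⇒sub h (λ x → ⇒refl _) p)
  ≅sub h ≅refl        = ≅refl
  ≅sub h (≅sym c)     = ≅sym (≅sub h c)
  ≅sub h (≅trans c d) = ≅trans (≅sub h c) (≅sub h d)

  ⇒[] : ∀ {Γ V V′ W T T′} → Γ ⊢ tp Γ V ≅ W → Γ ⊢ V ⇒ V′ → Γ ▷ W ⊢ T ⇒ T′ →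
        Γ ⊢ T [ V ] ⇒ T′ [ V′ ]
  ⇒[] {Γ} {V} {V′} c p = ⇒sub (IsSub-∷ c) e
    where
    e : ∀ x → Γ ⊢ (V ∷ₛ ref) x ⇒ (V′ ∷ₛ ref) x
    e zero    = p
    e (suc x) = ⇒ref

  -- The identity is a typed substitution between the two contexts.
  ⇒ctx : ∀ {Γ W W′ T T′} → Γ ⊢ W ≅ W′ → Γ ▷ W ⊢ T ⇒ T′ → Γ ▷ W′ ⊢ T ⇒ T′
  ⇒ctx {Γ} {W′ = W′} c p =
    subst₂ (Γ ▷ W′ ⊢_⇒_) (sub-id (λ _ → refl) _) (sub-id (λ _ → refl) _)
      (⇒sub (IsSub-▷ c) (λ x → ⇒ref) p)

  tp-ctx : ∀ {Γ W W′} → Γ ⊢ W ≅ W′ → ∀ T → Γ ▷ W′ ⊢ tp (Γ ▷ W′) T ≅ tp (Γ ▷ W) T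
  tp-ctx {Γ} {W′ = W′} c T =
    subst₂ (Γ ▷ W′ ⊢_≅_) (cong (tp _) (sub-id (λ _ → refl) T)) (sub-id (λ _ → refl) _)
      (tp-sub (IsSub-▷ c) T)

  -- The critical case is a contraction: the body is typed with the bound variable of type `W`, the
  -- contractum with `V′` and its own type in that place. The check makes these two types
  -- convertible, so `tp-sub` applies.
  tp-⇒ : ∀ {Γ T T′} → Γ ⊢ T ⇒ T′ → Γ ⊢ tp Γ T ≅ tp Γ T′
  tp-⇒ ⇒srt       = ≅refl
  tp-⇒ ⇒ref       = ≅refl
  tp-⇒ (⇒apl p q) = ≅apl (≅step p) (tp-⇒ q)
  tp-⇒ (⇒abs {T′ = T′} p q) =
    ≅abs (≅step p) (≅trans (tp-⇒ q) (tp-ctx (≅sym (≅step p)) T′))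
  tp-⇒ {Γ} (⇒β {V′ = V′} {W} {T′ = T′} p q c) =
    ≅trans (≅apl (≅step p) (≅abs ≅refl (tp-⇒ q)))
      (≅trans (≅step (⇒β (⇒refl V′) (⇒refl (tp (Γ ▷ W) T′)) c′))
        (≅sym (tp-sub (IsSub-∷ c′) T′)))
    -- The check passes from `V` to `V′` by the induction hypothesis for `p`.
    where c′ = ≅trans (≅sym (tp-⇒ p)) c

  tp-≅ : ∀ {Γ T T′} → Γ ⊢ T ≅ T′ → Γ ⊢ tp Γ T ≅ tp Γ T′
  tp-≅ (≅step p)    = tp-⇒ p
  tp-≅ ≅refl        = ≅refl
  tp-≅ (≅sym c)     = ≅sym (tp-≅ c)
  tp-≅ (≅trans c d) = ≅trans (tp-≅ c) (tp-≅ d)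

  -- Confluence of checked reduction.

  ⇒-diamond : ∀ {Γ T T₁ T₂} → Γ ⊢ T ⇒ T₁ → Γ ⊢ T ⇒ T₂ → ∃ λ T₃ → (Γ ⊢ T₁ ⇒ T₃) × (Γ ⊢ T₂ ⇒ T₃)
  ⇒-diamond ⇒srt ⇒srt = _ , ⇒srt , ⇒srt
  ⇒-diamond ⇒ref ⇒ref = _ , ⇒ref , ⇒ref
  ⇒-diamond (⇒apl p q) (⇒apl p′ q′) =
    let _ , r , r′ = ⇒-diamond p p′ ; _ , s , s′ = ⇒-diamond q q′ in
    _ , ⇒apl r s , ⇒apl r′ s′
  ⇒-diamond (⇒abs p q) (⇒abs p′ q′) =
    let _ , r , r′ = ⇒-diamond p p′ ; _ , s , s′ = ⇒-diamond q q′ in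
    _ , ⇒abs r (⇒ctx (≅step p) s) , ⇒abs r′ (⇒ctx (≅step p′) s′)
  ⇒-diamond (⇒apl p (⇒abs w q)) (⇒β p′ q′ c) =
    let _ , r , r′ = ⇒-diamond p p′ ; _ , s , s′ = ⇒-diamond q q′ in
    -- The redex that is left has to be checked anew. The type of its argument has moved only up to
    -- conversion, by `tp-⇒`, and its domain by the step `w`. Checks are transported but never
    -- analysed, so recursion on the two steps suffices.
    _ , ⇒β r (⇒ctx (≅step w) s) (≅trans (≅sym (tp-⇒ p)) (≅trans c (≅step w)))
      , ⇒[] (≅trans (≅sym (tp-⇒ p′)) c) r′ s′
  ⇒-diamond (⇒β p q c) (⇒apl p′ (⇒abs w q′)) =
    let _ , r , r′ = ⇒-diamond p p′ ; _ , s , s′ = ⇒-diamond q q′ in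
    _ , ⇒[] (≅trans (≅sym (tp-⇒ p)) c) r s
      , ⇒β r′ (⇒ctx (≅step w) s′) (≅trans (≅sym (tp-⇒ p′)) (≅trans c (≅step w)))
  ⇒-diamond (⇒β p q c) (⇒β p′ q′ c′) =
    let _ , r , r′ = ⇒-diamond p p′ ; _ , s , s′ = ⇒-diamond q q′ in
    _ , ⇒[] (≅trans (≅sym (tp-⇒ p)) c) r s
      , ⇒[] (≅trans (≅sym (tp-⇒ p′)) c) r′ s′

  data _⊢_⇒*_ (Γ : Ctx) : Tm S → Tm S → Set where
    []  : ∀ {T} → Γ ⊢ T ⇒* T
    _∷_ : ∀ {T T′ T″} → Γ ⊢ T ⇒ T′ → Γ ⊢ T′ ⇒* T″ → Γ ⊢ T ⇒* T″

  ⇒*-trans : ∀ {Γ T T′ T″} → Γ ⊢ T ⇒* T′ → Γ ⊢ T′ ⇒* T″ → Γ ⊢ T ⇒* T″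
  ⇒*-trans []       qs = qs
  ⇒*-trans (p ∷ ps) qs = p ∷ ⇒*-trans ps qs

  ⇒-strip : ∀ {Γ T T₁ T₂} → Γ ⊢ T ⇒ T₁ → Γ ⊢ T ⇒* T₂ → ∃ λ T₃ → (Γ ⊢ T₁ ⇒* T₃) × (Γ ⊢ T₂ ⇒ T₃)
  ⇒-strip p []       = _ , [] , p
  ⇒-strip p (q ∷ qs) =
    let _ , r , p′ = ⇒-diamond p q ; _ , rs , p″ = ⇒-strip p′ qs in
    _ , r ∷ rs , p″

  ⇒*-confluent : ∀ {Γ T T₁ T₂} → Γ ⊢ T ⇒* T₁ → Γ ⊢ T ⇒* T₂ →
                 ∃ λ T₃ → (Γ ⊢ T₁ ⇒* T₃) × (Γ ⊢ T₂ ⇒* T₃)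
  ⇒*-confluent []       qs = _ , qs , []
  ⇒*-confluent (p ∷ ps) qs =
    let _ , rs , p′ = ⇒-strip p qs ; _ , ss , ts = ⇒*-confluent ps rs in
    _ , ss , p′ ∷ ts

  church-rosser : ∀ {Γ T₁ T₂} → Γ ⊢ T₁ ≅ T₂ → ∃ λ T₃ → (Γ ⊢ T₁ ⇒* T₃) × (Γ ⊢ T₂ ⇒* T₃)
  church-rosser (≅step p) = _ , p ∷ [] , []
  church-rosser ≅refl     = _ , [] , []
  church-rosser (≅sym c)  = let _ , ps , qs = church-rosser c in _ , qs , ps
  church-rosser (≅trans c d) =
    let _ , ps , qs = church-rosser c ; _ , ps′ , qs′ = church-rosser d
        _ , rs , rs′ = ⇒*-confluent qs ps′ in
    _ , ⇒*-trans ps rs , ⇒*-trans qs′ rs′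

  abs-⇒* : ∀ {Γ W T X} → Γ ⊢ abs W T ⇒* X →
           ∃ λ W′ → ∃ λ T′ → (X ≡ abs W′ T′) × (Γ ⊢ W ⇒* W′)
  abs-⇒* [] = _ , _ , refl , []
  abs-⇒* (⇒abs p q ∷ ps) = let _ , _ , e , ps′ = abs-⇒* ps in _ , _ , e , p ∷ ps′

  ⇒*-≅ : ∀ {Γ T T′} → Γ ⊢ T ⇒* T′ → Γ ⊢ T ≅ T′
  ⇒*-≅ []       = ≅refl
  ⇒*-≅ (p ∷ ps) = ≅trans (≅step p) (⇒*-≅ ps)

  -- By confluence both sides meet in one abstraction, whose domain is a reduct of `W` and of `W′`.
  -- This will recover the check of a β-redex from the side condition on applications.
  abs-injective : ∀ {Γ W W′ T T′} → Γ ⊢ abs W T ≅ abs W′ T′ → Γ ⊢ W ≅ W′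
  abs-injective c with church-rosser c
  ... | X , ps , qs with abs-⇒* ps | abs-⇒* qs
  ... | _ , _ , refl , ps′ | _ , _ , refl , qs′ = ≅trans (⇒*-≅ ps′) (≅sym (⇒*-≅ qs′))

  tp^-≅ : ∀ n {Γ T T′} → Γ ⊢ T ≅ T′ → Γ ⊢ tp^ n Γ T ≅ tp^ n Γ T′
  tp^-≅ zero    c = c
  tp^-≅ (suc n) c = tp-≅ (tp^-≅ n c)

  tp^-ren : ∀ n {ρ Γ Δ} → IsRen ρ Γ Δ → ∀ T → tp^ n Δ (ren ρ T) ≡ ren ρ (tp^ n Γ T)
  tp^-ren zero    h T = refl
  tp^-ren (suc n) h T = trans (cong (tp _) (tp^-ren n h T)) (tp-ren h (tp^ n _ T))

  tp^-sub : ∀ n {σ Γ Δ} → IsSub σ Γ Δ → ∀ T → Δ ⊢ tp^ n Δ (sub σ T) ≅ sub σ (tp^ n Γ T)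
  tp^-sub zero    h T = ≅refl
  tp^-sub (suc n) h T = ≅trans (tp-≅ (tp^-sub n h T)) (tp-sub h (tp^ n _ T))

  tp^-apl : ∀ n {Γ V T} → tp^ n Γ (apl V T) ≡ apl V (tp^ n Γ T)
  tp^-apl zero    = refl
  tp^-apl (suc n) = cong (tp _) (tp^-apl n)

  tp^-abs : ∀ n {Γ W T} → tp^ n Γ (abs W T) ≡ abs W (tp^ n (Γ ▷ W) T)
  tp^-abs zero    = refl
  tp^-abs (suc n) = cong (tp _) (tp^-abs n)

  tp^-+ : ∀ m n {Γ T} → tp^ (m + n) Γ T ≡ tp^ m Γ (tp^ n Γ T)
  tp^-+ zero    n = refl
  tp^-+ (suc m) n = cong (tp _) (tp^-+ m n)

  tp^-comm : ∀ m n {Γ T} → tp^ m Γ (tp^ n Γ T) ≡ tp^ n Γ (tp^ m Γ T)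
  tp^-comm m n {Γ} {T} =
    trans (sym (tp^-+ m n)) (trans (cong (λ k → tp^ k Γ T) (+-comm m n)) (tp^-+ n m))

-- Renaming in the source calculus and the interpretation of terms.

module _ {S : Set} where

  renₜ : (ℕ → ℕ) → Term S → Term S
  renₜ r (sort s)     = sort s
  renₜ r (var x)      = var (r x)
  renₜ r (app V T)    = app (renₜ r V) (renₜ r T)
  renₜ r (bind b V T) = bind b (renₜ r V) (renₜ (⇑ᵣ r) T)
  renₜ r (cast U T)   = cast (renₜ r U) (renₜ r T)

  renₜ-id : ∀ {r} → (∀ x → r x ≡ x) → ∀ T → renₜ r T ≡ T
  renₜ-id e (sort s)     = refl
  renₜ-id e (var x)      = cong var (e x)
  renₜ-id e (app V T)    = cong₂ app (renₜ-id e V) (renₜ-id e T)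
  renₜ-id e (bind b V T) =
    cong₂ (bind b) (renₜ-id e V) (renₜ-id (λ { zero → refl ; (suc x) → cong suc (e x) }) T)
  renₜ-id e (cast U T)   = cong₂ cast (renₜ-id e U) (renₜ-id e T)

  renₜ-renₜ : ∀ {r₁ r₂ r₃} → (∀ x → r₂ (r₁ x) ≡ r₃ x) →
              ∀ T → renₜ r₂ (renₜ r₁ T) ≡ renₜ r₃ T
  renₜ-renₜ e (sort s)     = refl
  renₜ-renₜ e (var x)      = cong var (e x)
  renₜ-renₜ e (app V T)    = cong₂ app (renₜ-renₜ e V) (renₜ-renₜ e T)
  renₜ-renₜ e (bind b V T) =
    cong₂ (bind b) (renₜ-renₜ e V)
      (renₜ-renₜ (λ { zero → refl ; (suc x) → cong suc (e x) }) T)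
  renₜ-renₜ e (cast U T)   = cong₂ cast (renₜ-renₜ e U) (renₜ-renₜ e T)

  -- `shift` tests each index against a cutoff, which is awkward to compose; a renaming described
  -- pointwise composes extensionally.
  IsShift : ℕ → (ℕ → ℕ) → Set
  IsShift c r = ∀ x → shift {S} c (var x) ≡ var (r x)

  IsShift-⇑ : ∀ {c r} → IsShift c r → IsShift (suc c) (⇑ᵣ r)
  IsShift-⇑ {c} h zero = refl
  IsShift-⇑ {c} {r} h (suc x) with x <? c | suc x <? suc c | h x
  ... | yes _ | yes _ | e = cong (λ { (var y) → var (suc y) ; T → T }) e
  ... | no _  | no _  | e = cong (λ { (var y) → var (suc y) ; T → T }) e
  ... | yes p | no q  | e = contradiction (s≤s p) q
  ... | no p  | yes (s≤s q) | e = contradiction q p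

  shift≡renₜ : ∀ {c r} → IsShift c r → ∀ T → shift c T ≡ renₜ r T
  shift≡renₜ h (sort s)     = refl
  shift≡renₜ h (var x)      = h x
  shift≡renₜ h (app V T)    = cong₂ app (shift≡renₜ h V) (shift≡renₜ h T)
  shift≡renₜ h (bind b V T) = cong₂ (bind b) (shift≡renₜ h V) (shift≡renₜ (IsShift-⇑ h) T)
  shift≡renₜ h (cast U T)   = cong₂ cast (shift≡renₜ h U) (shift≡renₜ h T)

  lift≡renₜ : ∀ T → lift T ≡ renₜ suc T
  lift≡renₜ = shift≡renₜ (λ _ → refl)

  lift-renₜ : ∀ r T → renₜ (⇑ᵣ r) (lift T) ≡ lift (renₜ r T)
  lift-renₜ r T =
    trans (cong (renₜ _) (lift≡renₜ T))
      (trans (renₜ-renₜ (λ _ → refl) T)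
        (sym (trans (lift≡renₜ _) (renₜ-renₜ (λ _ → refl) T))))

  infix 10 ⟦_⟧

  ⟦_⟧ : Term S → (ℕ → Tm S) → Tm S
  ⟦ sort s ⟧ ρ        = srt s
  ⟦ var x ⟧ ρ         = ρ x
  ⟦ app V T ⟧ ρ       = apl (⟦ V ⟧ ρ) (⟦ T ⟧ ρ)
  ⟦ bind abst W T ⟧ ρ = abs (⟦ W ⟧ ρ) (⟦ T ⟧ (⇑ ρ))
  ⟦ bind abbr V T ⟧ ρ = ⟦ T ⟧ (⟦ V ⟧ ρ ∷ₛ ρ)
  ⟦ cast U T ⟧ ρ      = ⟦ T ⟧ ρ

  val : Env S → ℕ → Tm S
  val ⋆              = ref
  val (L ,[ abst ] W) = ⇑ (val L)
  val (L ,[ abbr ] V) = ⟦ V ⟧ (val L) ∷ₛ val L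

  ⟦_⟧⟨_⟩ : Term S → Env S → Tm S
  ⟦ T ⟧⟨ L ⟩ = ⟦ T ⟧ (val L)

  -- The substitution on the right serves both kinds of lifting: it is `ref ∘ suc` past an
  -- abstraction and `ref` past a definition.
  ⟦⟧-renₜ : ∀ {r σ ρ ρ′} → (∀ x → ρ′ (r x) ≡ sub σ (ρ x)) →
            ∀ T → ⟦ renₜ r T ⟧ ρ′ ≡ sub σ (⟦ T ⟧ ρ)
  ⟦⟧-renₜ e (sort s)        = refl
  ⟦⟧-renₜ e (var x)         = e x
  ⟦⟧-renₜ e (app V T)       = cong₂ apl (⟦⟧-renₜ e V) (⟦⟧-renₜ e T)
  ⟦⟧-renₜ {ρ = ρ} e (bind abst W T) =
    cong₂ abs (⟦⟧-renₜ e W)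
      (⟦⟧-renₜ (λ { zero → refl ; (suc x) → trans (cong wk (e x)) (sym (wk-sub _ (ρ x))) }) T)
  ⟦⟧-renₜ e (bind abbr V T) =
    ⟦⟧-renₜ (λ { zero → ⟦⟧-renₜ e V ; (suc x) → e x }) T
  ⟦⟧-renₜ e (cast U T)      = ⟦⟧-renₜ e T

  -- A definition occupies no index in the interpretation, so lifting past it is invisible there.
  wkᵇ : Binder → Tm S → Tm S
  wkᵇ abst = wk
  wkᵇ abbr = id

  ⟦lift⟧ : ∀ L b V T → ⟦ lift T ⟧⟨ L ,[ b ] V ⟩ ≡ wkᵇ b ⟦ T ⟧⟨ L ⟩
  ⟦lift⟧ L abst V T =
    trans (cong (λ T → ⟦ T ⟧⟨ L ,[ abst ] V ⟩) (lift≡renₜ T))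
      (trans (⟦⟧-renₜ (λ x → ren≡sub suc (val L x)) T) (sym (ren≡sub suc _)))
  ⟦lift⟧ L abbr V T =
    trans (cong (λ T → ⟦ T ⟧⟨ L ,[ abbr ] V ⟩) (lift≡renₜ T))
      (trans (⟦⟧-renₜ (λ x → sym (sub-id (λ _ → refl) (val L x))) T) (sub-id (λ _ → refl) _))

-- Preservation of validity under reduction.

module Preservation {S : Set} (next : S → S) where

  open Conversion next

  ⟦_⟧ᶜ : Env S → Ctx
  -- A default type for indices out of scope, which `dom` excludes later.
  ⟦ ⋆ ⟧ᶜ             = ref
  ⟦ L ,[ abst ] W ⟧ᶜ = ⟦ L ⟧ᶜ ▷ ⟦ W ⟧⟨ L ⟩
  ⟦ L ,[ abbr ] V ⟧ᶜ = ⟦ L ⟧ᶜ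

  ⟦⟧-sub : ∀ {σ Γ Δ r′ r ρ′ ρ} → IsSub σ Γ Δ → (∀ x → Δ ⊢ ρ (r x) ≅ sub σ (ρ′ (r′ x))) →
           ∀ T → Δ ⊢ ⟦ renₜ r T ⟧ ρ ≅ sub σ (⟦ renₜ r′ T ⟧ ρ′)
  ⟦⟧-sub h e (sort s)        = ≅refl
  ⟦⟧-sub h e (var x)         = e x
  ⟦⟧-sub h e (app V T)       = ≅apl (⟦⟧-sub h e V) (⟦⟧-sub h e T)
  ⟦⟧-sub {r′ = r′} {ρ′ = ρ′} h e (bind abst W T) =
    -- The two readings of the domain are merely convertible, hence `IsSub-⇑≅` with `c`.
    ≅abs c (⟦⟧-sub (IsSub-⇑≅ {W = ⟦ renₜ r′ W ⟧ ρ′} h c)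
      (λ { zero → ≅refl ; (suc x) → ≅trans (≅wk (e x)) (≅reflexive (sym (wk-sub _ (ρ′ _)))) }) T)
    where c = ⟦⟧-sub h e W
  ⟦⟧-sub h e (bind abbr V T) =
    ⟦⟧-sub h (λ { zero → ⟦⟧-sub h e V ; (suc x) → e x }) T
  ⟦⟧-sub h e (cast U T)      = ⟦⟧-sub h e T

  -- Validity with its side conditions read in the interpretation, which makes it
  -- independent of 𝒜 and stable under conversion.
  data Good : Env S → Term S → Set where
    g-sort : ∀ {L s} → Good L (sort s)
    g-zero : ∀ {K b V} → Good K V → Good (K ,[ b ] V) (var 0)
    g-lref : ∀ {K b V i} → Good K (var i) → Good (K ,[ b ] V) (var (suc i))
    g-bind : ∀ {L b V T} → Good L V → Good (L ,[ b ] V) T → Good L (bind b V T)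
    g-cast : ∀ {L U T} → Good L U → Good L T →
             ⟦ L ⟧ᶜ ⊢ ⟦ U ⟧⟨ L ⟩ ≅ tp ⟦ L ⟧ᶜ ⟦ T ⟧⟨ L ⟩ → Good L (cast U T)
    g-app  : ∀ {L V T n W₀ U₀} → Good L V → Good L T →
             ⟦ L ⟧ᶜ ⊢ tp^ n ⟦ L ⟧ᶜ ⟦ T ⟧⟨ L ⟩ ≅ abs W₀ U₀ →
             ⟦ L ⟧ᶜ ⊢ tp ⟦ L ⟧ᶜ ⟦ V ⟧⟨ L ⟩ ≅ W₀ → Good L (app V T)

  -- Having a renaming on either side lets one transport lemma cover weakening,
  -- strengthening and replacement of an entry of the environment.
  record EnvMap (r′ r : ℕ → ℕ) (L′ L : Env S) : Set where
    field
      σ     : ℕ → Tm S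
      isSub : IsSub σ ⟦ L′ ⟧ᶜ ⟦ L ⟧ᶜ
      vals  : ∀ x → ⟦ L ⟧ᶜ ⊢ val L (r x) ≅ sub σ (val L′ (r′ x))
      vars  : ∀ x → Good L′ (var (r′ x)) → Good L (var (r x))

    ⟦⟧-map : ∀ T → ⟦ L ⟧ᶜ ⊢ ⟦ renₜ r T ⟧⟨ L ⟩ ≅ sub σ ⟦ renₜ r′ T ⟧⟨ L′ ⟩
    ⟦⟧-map = ⟦⟧-sub isSub vals
  open EnvMap

  EnvMap-⇑ : ∀ {r′ r L′ L} → EnvMap r′ r L′ L → ∀ b V → Good L (renₜ r V) →
             EnvMap (⇑ᵣ r′) (⇑ᵣ r) (L′ ,[ b ] renₜ r′ V) (L ,[ b ] renₜ r V)
  EnvMap-⇑ m abst V g .σ     = ⇑ (m .σ)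
  EnvMap-⇑ m abbr V g .σ     = m .σ
  EnvMap-⇑ m abst V g .isSub = IsSub-⇑≅ (m .isSub) (⟦⟧-map m V)
  EnvMap-⇑ m abbr V g .isSub = m .isSub
  EnvMap-⇑ m abst V g .vals zero = ≅refl
  EnvMap-⇑ {L′ = L′} m abst V g .vals (suc x) =
    ≅trans (≅wk (m .vals x)) (≅reflexive (sym (wk-sub _ (val L′ _))))
  EnvMap-⇑ m abbr V g .vals zero    = ⟦⟧-map m V
  EnvMap-⇑ m abbr V g .vals (suc x) = m .vals x
  EnvMap-⇑ m b V g .vars zero    _          = g-zero g
  EnvMap-⇑ m b V g .vars (suc x) (g-lref h) = g-lref (m .vars x h)

  tp-⟦⟧-map : ∀ {r′ r L′ L} (m : EnvMap r′ r L′ L) n T →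
    ⟦ L ⟧ᶜ ⊢ tp^ n ⟦ L ⟧ᶜ ⟦ renₜ r T ⟧⟨ L ⟩ ≅ sub (m .σ) (tp^ n ⟦ L′ ⟧ᶜ ⟦ renₜ r′ T ⟧⟨ L′ ⟩)
  tp-⟦⟧-map m n T = ≅trans (tp^-≅ n (⟦⟧-map m T)) (tp^-sub n (m .isSub) _)

  Good-map : ∀ {r′ r L′ L} → EnvMap r′ r L′ L → ∀ T → Good L′ (renₜ r′ T) → Good L (renₜ r T)
  Good-map m (sort s)     g-sort        = g-sort
  Good-map m (var x)      g             = m .vars x g
  Good-map m (app V T)    (g-app {n = n} gV gT c d) =
    g-app {n = n} (Good-map m V gV) (Good-map m T gT)
      (≅trans (tp-⟦⟧-map m n T) (≅sub (m .isSub) c))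
      (≅trans (tp-⟦⟧-map m 1 V) (≅sub (m .isSub) d))
  Good-map m (bind b V T) (g-bind gV gT) =
    let gV′ = Good-map m V gV in g-bind gV′ (Good-map (EnvMap-⇑ m b V gV′) T gT)
  Good-map m (cast U T)   (g-cast gU gT c) =
    g-cast (Good-map m U gU) (Good-map m T gT)
      (≅trans (⟦⟧-map m U) (≅trans (≅sub (m .isSub) c) (≅sym (tp-⟦⟧-map m 1 T))))

  IsSub-ref : ∀ {Γ} → IsSub ref Γ Γ
  IsSub-ref .IsSub.at x = ≅reflexive (sym (sub-id (λ _ → refl) _))

  IsSub-suc : ∀ {Γ W} → IsSub (ref ∘ suc) Γ (Γ ▷ W)
  IsSub-suc .IsSub.at x = ≅reflexive (ren≡sub suc _)

  EnvMap-weaken : ∀ {L} b {V} → EnvMap id suc L (L ,[ b ] V)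
  EnvMap-weaken abst .σ     = ref ∘ suc
  EnvMap-weaken abbr .σ     = ref
  EnvMap-weaken abst .isSub = IsSub-suc
  EnvMap-weaken abbr .isSub = IsSub-ref
  EnvMap-weaken abst .vals x = ≅reflexive (ren≡sub suc _)
  EnvMap-weaken abbr .vals x = ≅reflexive (sym (sub-id (λ _ → refl) _))
  EnvMap-weaken b    .vars x = g-lref

  -- With `suc` on the source side only lifted terms are transported, that is, those in which the
  -- definition does not occur. This serves `zeta`.
  EnvMap-strengthen : ∀ {L V} → EnvMap suc id (L ,[ abbr ] V) L
  EnvMap-strengthen .σ                 = ref
  EnvMap-strengthen .isSub             = IsSub-ref
  EnvMap-strengthen .vals x            = ≅reflexive (sym (sub-id (λ _ → refl) _))
  EnvMap-strengthen .vars x (g-lref g) = g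

  -- Turning an abstraction entry into a definition amounts to substituting the value, and the check
  -- of `⇒β` is what makes this substitution typed.
  EnvMap-β : ∀ {L V W} → Good L V → ⟦ L ⟧ᶜ ⊢ tp ⟦ L ⟧ᶜ ⟦ V ⟧⟨ L ⟩ ≅ ⟦ W ⟧⟨ L ⟩ →
             EnvMap id id (L ,[ abst ] W) (L ,[ abbr ] V)
  EnvMap-β {L} {V} g c .σ              = ⟦ V ⟧⟨ L ⟩ ∷ₛ ref
  EnvMap-β g c .isSub                  = IsSub-∷ c
  EnvMap-β g c .vals zero              = ≅refl
  EnvMap-β g c .vals (suc x)           = ≅reflexive (sym (wk-[] _ _))
  EnvMap-β g c .vars zero _            = g-zero g
  EnvMap-β g c .vars (suc x) (g-lref h) = g-lref h

  EnvMap-replace : ∀ {L} b {V V′} → Good L V′ → ⟦ L ⟧ᶜ ⊢ ⟦ V ⟧⟨ L ⟩ ≅ ⟦ V′ ⟧⟨ L ⟩ →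
                   EnvMap id id (L ,[ b ] V) (L ,[ b ] V′)
  EnvMap-replace b    g c .σ              = ref
  EnvMap-replace abst g c .isSub          = IsSub-▷ c
  EnvMap-replace abbr g c .isSub          = IsSub-ref
  EnvMap-replace abst g c .vals x         = ≅reflexive (sym (sub-id (λ _ → refl) _))
  EnvMap-replace abbr g c .vals zero      = ≅trans (≅sym c) (≅reflexive (sym (sub-id (λ _ → refl) _)))
  EnvMap-replace abbr g c .vals (suc x)   = ≅reflexive (sym (sub-id (λ _ → refl) _))
  EnvMap-replace b    g c .vars zero    _ = g-zero g
  EnvMap-replace b    g c .vars (suc x) (g-lref h) = g-lref h

  Good-mapᵢ : ∀ {L′ L} → EnvMap id id L′ L → ∀ {T} → Good L′ T → Good L T
  Good-mapᵢ {L′} {L} m {T} g =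
    subst (Good L) (renₜ-id (λ _ → refl) T)
      (Good-map m T (subst (Good L′) (sym (renₜ-id (λ _ → refl) T)) g))

  ⟦⟧-mapᵢ : ∀ {L′ L} (m : EnvMap id id L′ L) T → ⟦ L ⟧ᶜ ⊢ ⟦ T ⟧⟨ L ⟩ ≅ sub (m .σ) ⟦ T ⟧⟨ L′ ⟩
  ⟦⟧-mapᵢ {L′} {L} m T =
    subst (λ U → ⟦ L ⟧ᶜ ⊢ ⟦ U ⟧⟨ L ⟩ ≅ sub (m .σ) ⟦ U ⟧⟨ L′ ⟩) (renₜ-id (λ _ → refl) T)
      (⟦⟧-map m T)

  Good-lift : ∀ {L} b {V T} → Good L T → Good (L ,[ b ] V) (lift T)
  Good-lift {L} b {V} {T} g =
    subst (Good (L ,[ b ] V)) (sym (lift≡renₜ T))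
      (Good-map (EnvMap-weaken b) T (subst (Good L) (sym (renₜ-id (λ _ → refl) T)) g))

  Good-unlift : ∀ {L V T} → Good (L ,[ abbr ] V) (lift T) → Good L T
  Good-unlift {L} {V} {T} g =
    subst (Good L) (renₜ-id (λ _ → refl) T)
      (Good-map EnvMap-strengthen T (subst (Good (L ,[ abbr ] V)) (lift≡renₜ T) g))

  ⟦bind⟧-≅ : ∀ {L} b {V V′} → Good L V → ⟦ L ⟧ᶜ ⊢ ⟦ V′ ⟧⟨ L ⟩ ≅ ⟦ V ⟧⟨ L ⟩ → ∀ T →
             ⟦ L ⟧ᶜ ⊢ ⟦ bind b V′ T ⟧⟨ L ⟩ ≅ ⟦ bind b V T ⟧⟨ L ⟩
  ⟦bind⟧-≅ abst g e T = ≅abs e ≅refl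
  ⟦bind⟧-≅ abbr {V} {V′} g e T =
    ≅trans (≅reflexive (sym (sub-id (λ _ → refl) _)))
      (≅sym (⟦⟧-mapᵢ (EnvMap-replace abbr {V′} {V} g e) T))

  -- Both claims are proved together, since the conversion obtained for a subterm is what restores
  -- the side condition of the term around it.
  preservation : ∀ {L T T′ n} → Good L T → _⊢_⟶[_]_ next L T n T′ →
                 Good L T′ × (⟦ L ⟧ᶜ ⊢ ⟦ T′ ⟧⟨ L ⟩ ≅ tp^ n ⟦ L ⟧ᶜ ⟦ T ⟧⟨ L ⟩)
  preservation {L} (g-app {n = n} {W₀} gV (g-bind {V = W} {T} gW gT) c d) beta =
      g-bind g (Good-mapᵢ m gT)
    , ≅trans (⟦⟧-mapᵢ m T) (≅sym (≅step (⇒β (⇒refl _) (⇒refl _) e)))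
    where
    -- Iterating `tp` on an abstraction keeps its domain, so `c` equates the domain of the redex
    -- with `W₀` whatever `n` is.
    e = ≅trans d (abs-injective (≅trans (≅sym c) (≅reflexive (tp^-abs n))))
    g = g-cast gW gV (≅sym e)
    m = EnvMap-β {W = W} g e
  preservation (g-zero {K} {V = V} g) delta = Good-lift abbr g , ≅reflexive (⟦lift⟧ K abbr V V)
  preservation {L} (g-bind _ g) (zeta {V = V} {T}) = Good-unlift g , ≅reflexive (sym (⟦lift⟧ L abbr V T))
  preservation {L} (g-app {V = V} {n = n} gV (g-bind gW gT) c d) (theta {W = W}) =
      -- `c` fits as it stands: the definition leaves the context unchanged, and interpreting it is
      -- interpreting its body.
      g-bind gW (g-app {n = n} (Good-lift abbr gV) gT c
        (≅trans (tp-≅ (≅reflexive (⟦lift⟧ L abbr W V))) d))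
    , ≅apl (≅reflexive (⟦lift⟧ L abbr W V)) ≅refl
  preservation (g-cast gU gT c) epsilon = gT , ≅refl
  preservation g-sort sortS = g-sort , ≅refl
  preservation (g-zero {K} {V = W} g) ldelta = Good-lift abst g , ≅reflexive (⟦lift⟧ K abst W W)
  preservation (g-cast gU gT c) ee = gU , c
  preservation (g-lref g) (lref {K} {n = n} {T} {abst} {V} p) =
    let gT , e = preservation g p in
      Good-lift abst gT
    , ≅trans (≅reflexive (⟦lift⟧ K abst V T))
        (≅trans (≅wk e) (≅reflexive (sym (tp^-ren n IsRen-wk _))))
  preservation (g-lref g) (lref {K} {T = T} {abbr} {V} p) =
    let gT , e = preservation g p in
    Good-lift abbr gT , ≅trans (≅reflexive (⟦lift⟧ K abbr V T)) e
  preservation (g-app {n = n} gV gT c d) (appL p) =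
    let gV′ , e = preservation gV p in
    g-app {n = n} gV′ gT c (≅trans (tp-≅ e) d) , ≅apl e ≅refl
  preservation {L} (g-app {T = T} {n} {W₀} {U₀} gV gT c d) (appR {n = k} p) =
    let gT′ , e = preservation gT p in
      g-app {n = n} gV gT′
        -- The `k` t-steps of `p` commute with the `n` of the side condition, and `tp^ k` of
        -- `abs W₀ U₀` has the same domain `W₀`.
        (≅trans (tp^-≅ n e) (≅trans (≅reflexive (tp^-comm n k))
          (≅trans (tp^-≅ k c) (≅reflexive (tp^-abs k))))) d
    , ≅trans (≅apl ≅refl e) (≅reflexive (sym (tp^-apl k)))
  preservation (g-bind {V = V} {T} gV gT) (bindL {b = b} p) =
    let gV′ , e = preservation gV p in
    g-bind gV′ (Good-mapᵢ (EnvMap-replace b gV′ (≅sym e)) gT) , ⟦bind⟧-≅ b {V = V} gV e T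
  preservation (g-bind {b = abst} gV gT) (bindR {n = k} p) =
    let gT′ , e = preservation gT p in
    g-bind gV gT′ , ≅trans (≅abs ≅refl e) (≅reflexive (sym (tp^-abs k)))
  preservation (g-bind {b = abbr} gV gT) (bindR p) =
    let gT′ , e = preservation gT p in g-bind gV gT′ , e
  preservation (g-cast gU gT c) (castL p) =
    let gU′ , e = preservation gU p in g-cast gU′ gT (≅trans e c) , ≅refl
  preservation (g-cast gU gT c) (castR p) =
    let gT′ , e = preservation gT p in g-cast gU gT′ (≅trans c (≅sym (tp-≅ e))) , e
  preservation (g-cast gU gT c) (castB p q) =
    let gU′ , d = preservation gU p ; gT′ , e = preservation gT q in
    g-cast gU′ gT′ (≅trans d (≅trans (tp-≅ c) (≅sym (tp-≅ e)))) , e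

  preservation* : ∀ {L T T′ n} → Good L T → _⊢_⟶*[_]_ next L T n T′ →
                  Good L T′ × (⟦ L ⟧ᶜ ⊢ ⟦ T′ ⟧⟨ L ⟩ ≅ tp^ n ⟦ L ⟧ᶜ ⟦ T ⟧⟨ L ⟩)
  preservation* g refl*     = g , ≅refl
  preservation* g (step* p) = preservation g p
  preservation* g (trans* {n₁ = m} {n} p q) =
    let g′ , e = preservation* g p ; g″ , e′ = preservation* g′ q in
    g″ , ≅trans e′ (≅trans (tp^-≅ n e)
           (≅reflexive (trans (tp^-comm n m) (sym (tp^-+ m n)))))

  -- The subterms are good by induction, so `preservation*` reads the reductions in the side
  -- conditions as conversions.
  Valid⇒Good : ∀ {𝒜 L T} → Valid next 𝒜 L T → Good L T
  Valid⇒Good v-sort       = g-sort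
  Valid⇒Good (v-zero v)   = g-zero (Valid⇒Good v)
  Valid⇒Good (v-lref v)   = g-lref (Valid⇒Good v)
  Valid⇒Good (v-bind v w) = g-bind (Valid⇒Good v) (Valid⇒Good w)
  Valid⇒Good (v-cast v w (_ , p , q)) =
    let g = Valid⇒Good v ; h = Valid⇒Good w in
    g-cast g h (≅trans (≅sym (proj₂ (preservation* g q))) (proj₂ (preservation* h p)))
  Valid⇒Good (v-app v w (n , _ , _ , _ , p , q)) =
    let g = Valid⇒Good v ; h = Valid⇒Good w in
    g-app {n = n} g h (≅sym (proj₂ (preservation* h p))) (≅sym (proj₂ (preservation* g q)))

-- Congruence and renaming for source reduction.

module Simulation {S : Set} (next : S → S) where

  open Conversion next
  open Preservation next

  infix 4 _⊢_⟶⟨_⟩_ _⊢_↠⟨_⟩_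

  _⊢_⟶⟨_⟩_ _⊢_↠⟨_⟩_ : Env S → Term S → ℕ → Term S → Set
  _⊢_⟶⟨_⟩_ = _⊢_⟶[_]_ next
  _⊢_↠⟨_⟩_ = _⊢_⟶*[_]_ next

  ↠-reflexive : ∀ {L T T′} → T ≡ T′ → L ⊢ T ↠⟨ 0 ⟩ T′
  ↠-reflexive refl = refl*

  ↠-trans₀ : ∀ {L T T′ T″ n} → L ⊢ T ↠⟨ n ⟩ T′ → L ⊢ T′ ↠⟨ 0 ⟩ T″ → L ⊢ T ↠⟨ n ⟩ T″
  ↠-trans₀ {n = n} p q = subst (_ ⊢ _ ↠⟨_⟩ _) (+-identityʳ n) (trans* p q)

  ↠-map : ∀ {L L′} {f : Term S → Term S} →
          (∀ {T T′ n} → L ⊢ T ⟶⟨ n ⟩ T′ → L′ ⊢ f T ⟶⟨ n ⟩ f T′) →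
          ∀ {T T′ n} → L ⊢ T ↠⟨ n ⟩ T′ → L′ ⊢ f T ↠⟨ n ⟩ f T′
  ↠-map h refl*        = refl*
  ↠-map h (step* p)    = step* (h p)
  ↠-map h (trans* p q) = trans* (↠-map h p) (↠-map h q)

  -- The index is a variable with an equation because the `n₁ + n₂` of `trans*` cannot be matched
  -- against 0.
  ↠-map₀ : ∀ {L L′} {f : Term S → Term S} →
           (∀ {T T′} → L ⊢ T ⟶⟨ 0 ⟩ T′ → L′ ⊢ f T ⟶⟨ 0 ⟩ f T′) →
           ∀ {T T′ n} → L ⊢ T ↠⟨ n ⟩ T′ → n ≡ 0 → L′ ⊢ f T ↠⟨ 0 ⟩ f T′
  ↠-map₀ h refl*        e    = refl*
  ↠-map₀ h (step* p)    refl = step* (h p)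
  ↠-map₀ h (trans* {n₁ = m} p q) e =
    trans* (↠-map₀ h p (m+n≡0⇒m≡0 m e)) (↠-map₀ h q (m+n≡0⇒n≡0 m e))

  ↠-app : ∀ {L V V′ T T′ n} → L ⊢ V ↠⟨ 0 ⟩ V′ → L ⊢ T ↠⟨ n ⟩ T′ → L ⊢ app V T ↠⟨ n ⟩ app V′ T′
  ↠-app p q = trans* (↠-map₀ appL p refl) (↠-map appR q)

  ↠-bind : ∀ {L b V V′ T T′} → L ⊢ V ↠⟨ 0 ⟩ V′ → L ,[ b ] V ⊢ T ↠⟨ 0 ⟩ T′ →
           L ⊢ bind b V T ↠⟨ 0 ⟩ bind b V′ T′
  ↠-bind p q = trans* (↠-map bindR q) (↠-map₀ bindL p refl)

  ⟶-resp : ∀ {L T T′ T″ n} → T′ ≡ T″ → L ⊢ T ⟶⟨ n ⟩ T′ → L ⊢ T ⟶⟨ n ⟩ T″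
  ⟶-resp refl p = p

  -- Only steps from variables consult the environment, so respecting these is enough to respect all
  -- steps.
  record RedMap (r : ℕ → ℕ) (L L′ : Env S) : Set where
    field at : ∀ {i n T} → L ⊢ var i ⟶⟨ n ⟩ T → L′ ⊢ var (r i) ⟶⟨ n ⟩ renₜ r T
  open RedMap

  RedMap-⇑ : ∀ {r L L′ b V} → RedMap r L L′ → RedMap (⇑ᵣ r) (L ,[ b ] V) (L′ ,[ b ] renₜ r V)
  RedMap-⇑ {V = V} m .at delta  = ⟶-resp (sym (lift-renₜ _ V)) delta
  RedMap-⇑ {V = V} m .at ldelta = ⟶-resp (sym (lift-renₜ _ V)) ldelta
  RedMap-⇑ m .at (lref {T = T} p) = ⟶-resp (sym (lift-renₜ _ T)) (lref (m .at p))

  RedMap-suc : ∀ {L b V} → RedMap suc L (L ,[ b ] V)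
  RedMap-suc .at p = ⟶-resp (lift≡renₜ _) (lref p)

  ⟶-renₜ : ∀ {r L L′ T T′ n} → RedMap r L L′ → L ⊢ T ⟶⟨ n ⟩ T′ → L′ ⊢ renₜ r T ⟶⟨ n ⟩ renₜ r T′
  ⟶-renₜ m beta       = beta
  ⟶-renₜ m delta      = m .at delta
  ⟶-renₜ {r} m (zeta {V = V} {T}) =
    subst (λ U → _ ⊢ def (renₜ r V) U ⟶⟨ 0 ⟩ renₜ r T) (sym (lift-renₜ r T)) zeta
  ⟶-renₜ {r} m (theta {V = V} {W} {T}) =
    ⟶-resp (cong (λ U → def (renₜ r W) (app U (renₜ (⇑ᵣ r) T))) (sym (lift-renₜ r V))) theta
  ⟶-renₜ m epsilon    = epsilon
  ⟶-renₜ m sortS      = sortS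
  ⟶-renₜ m ldelta     = m .at ldelta
  ⟶-renₜ m ee         = ee
  ⟶-renₜ m (lref p)   = m .at (lref p)
  ⟶-renₜ m (appL p)   = appL (⟶-renₜ m p)
  ⟶-renₜ m (appR p)   = appR (⟶-renₜ m p)
  ⟶-renₜ m (bindL p)  = bindL (⟶-renₜ m p)
  ⟶-renₜ m (bindR p)  = bindR (⟶-renₜ (RedMap-⇑ m) p)
  ⟶-renₜ m (castL p)  = castL (⟶-renₜ m p)
  ⟶-renₜ m (castR p)  = castR (⟶-renₜ m p)
  ⟶-renₜ m (castB p q) = castB (⟶-renₜ m p) (⟶-renₜ m q)

  ↠-lift : ∀ {L b V T T′ n} → L ⊢ T ↠⟨ n ⟩ T′ → L ,[ b ] V ⊢ lift T ↠⟨ n ⟩ lift T′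
  ↠-lift = ↠-map λ p →
    subst₂ (_ ⊢_⟶⟨ _ ⟩_) (sym (lift≡renₜ _)) (sym (lift≡renₜ _)) (⟶-renₜ RedMap-suc p)

  module _ {𝒜 : ℕ → Set} where

    record ValidMap (r : ℕ → ℕ) (L L′ : Env S) : Set where
      field
        red  : RedMap r L L′
        vars : ∀ {i} → Valid next 𝒜 L (var i) → Valid next 𝒜 L′ (var (r i))
    open ValidMap

    ValidMap-⇑ : ∀ {r L L′ b V} → ValidMap r L L′ → Valid next 𝒜 L′ (renₜ r V) →
                 ValidMap (⇑ᵣ r) (L ,[ b ] V) (L′ ,[ b ] renₜ r V)
    ValidMap-⇑ m v .red             = RedMap-⇑ (m .red)
    ValidMap-⇑ m v .vars (v-zero _) = v-zero v
    ValidMap-⇑ m v .vars (v-lref w) = v-lref (m .vars w)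

    Valid-renₜ : ∀ {r L L′ T} → ValidMap r L L′ → Valid next 𝒜 L T → Valid next 𝒜 L′ (renₜ r T)
    Valid-renₜ m v-sort       = v-sort
    Valid-renₜ m (v-zero v)   = m .vars (v-zero v)
    Valid-renₜ m (v-lref v)   = m .vars (v-lref v)
    Valid-renₜ m (v-bind v w) =
      let v′ = Valid-renₜ m v in v-bind v′ (Valid-renₜ (ValidMap-⇑ m v′) w)
    Valid-renₜ m (v-cast v w (_ , p , q)) =
      v-cast (Valid-renₜ m v) (Valid-renₜ m w)
        (_ , ↠-map (⟶-renₜ (m .red)) p , ↠-map (⟶-renₜ (m .red)) q)
    Valid-renₜ m (v-app v w (n , a , _ , _ , p , q)) =
      v-app (Valid-renₜ m v) (Valid-renₜ m w)
        (n , a , _ , _ , ↠-map (⟶-renₜ (m .red)) p , ↠-map (⟶-renₜ (m .red)) q)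

    Valid-lift : ∀ {L b V T} → Valid next 𝒜 L T → Valid next 𝒜 (L ,[ b ] V) (lift T)
    Valid-lift {T = T} v =
      subst (Valid next 𝒜 _) (sym (lift≡renₜ T))
        (Valid-renₜ (record { red = RedMap-suc ; vars = v-lref }) v)

  -- Reading interpreted terms and their reductions back.

  emb : (ℕ → ℕ) → Tm S → Term S
  emb θ (srt s)   = sort s
  emb θ (ref x)   = var (θ x)
  emb θ (apl V T) = app (emb θ V) (emb θ T)
  emb θ (abs W T) = lam (emb θ W) (emb (⇑ᵣ θ) T)

  renₜ-emb : ∀ {r θ θ′} → (∀ x → r (θ x) ≡ θ′ x) → ∀ T → renₜ r (emb θ T) ≡ emb θ′ T
  renₜ-emb e (srt s)   = refl
  renₜ-emb e (ref x)   = cong var (e x)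
  renₜ-emb e (apl V T) = cong₂ app (renₜ-emb e V) (renₜ-emb e T)
  renₜ-emb e (abs W T) =
    cong₂ lam (renₜ-emb e W) (renₜ-emb (λ { zero → refl ; (suc x) → cong suc (e x) }) T)

  emb-ren : ∀ {ρ θ θ′} → (∀ x → θ (ρ x) ≡ θ′ x) → ∀ T → emb θ (ren ρ T) ≡ emb θ′ T
  emb-ren e (srt s)   = refl
  emb-ren e (ref x)   = cong var (e x)
  emb-ren e (apl V T) = cong₂ app (emb-ren e V) (emb-ren e T)
  emb-ren e (abs W T) =
    cong₂ lam (emb-ren e W) (emb-ren (λ { zero → refl ; (suc x) → cong suc (e x) }) T)

  lift-emb : ∀ θ T → lift (emb θ T) ≡ emb (suc ∘ θ) T
  lift-emb θ T = trans (lift≡renₜ _) (renₜ-emb (λ _ → refl) T)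

  lift-emb-wk : ∀ θ T → lift (emb θ T) ≡ emb (⇑ᵣ θ) (wk T)
  lift-emb-wk θ T = trans (lift-emb θ T) (sym (emb-ren (λ _ → refl) T))

  -- The interpretation omits the definitions in L, hence the change of index.
  pos : Env S → ℕ → ℕ
  pos ⋆              = id
  pos (L ,[ abst ] W) = ⇑ᵣ (pos L)
  pos (L ,[ abbr ] V) = suc ∘ pos L

  ⌈_⌉⟨_⟩ : Tm S → Env S → Term S
  ⌈ T ⌉⟨ L ⟩ = emb (pos L) T

  ↠-zeta : ∀ {L V T T′} → L ,[ abbr ] V ⊢ T ↠⟨ 0 ⟩ lift T′ → L ⊢ def V T ↠⟨ 0 ⟩ T′
  ↠-zeta p = trans* (↠-map bindR p) (step* zeta)

  Unfolds : Env S → Term S → Set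
  Unfolds L T = L ⊢ T ↠⟨ 0 ⟩ ⌈ ⟦ T ⟧⟨ L ⟩ ⌉⟨ L ⟩

  Unfolds-abst : ∀ {L W} → (∀ i → Unfolds L (var i)) → ∀ i → Unfolds (L ,[ abst ] W) (var i)
  Unfolds-abst h zero    = refl*
  Unfolds-abst {L} h (suc i) = ↠-trans₀ (↠-lift (h i)) (↠-reflexive (lift-emb-wk _ (val L i)))

  Unfolds-abbr : ∀ {L V} → (∀ i → Unfolds L (var i)) → Unfolds L V →
                 ∀ i → Unfolds (L ,[ abbr ] V) (var i)
  Unfolds-abbr {L} {V} h p zero =
    trans* (step* delta) (↠-trans₀ (↠-lift p) (↠-reflexive (lift-emb _ ⟦ V ⟧⟨ L ⟩)))
  Unfolds-abbr {L} h p (suc i) = ↠-trans₀ (↠-lift (h i)) (↠-reflexive (lift-emb _ (val L i)))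

  -- Variables are a hypothesis so that recursion on the term, which extends the environment, stays
  -- apart from recursion on the environment in `Unfolds-var`.
  Unfolds-term : ∀ L → (∀ i → Unfolds L (var i)) → ∀ T → Unfolds L T
  Unfolds-term L h (sort s)        = refl*
  Unfolds-term L h (var i)         = h i
  Unfolds-term L h (app V T)       = ↠-app (Unfolds-term L h V) (Unfolds-term L h T)
  Unfolds-term L h (bind abst W T) =
    ↠-bind (Unfolds-term L h W) (Unfolds-term (L ,[ abst ] W) (Unfolds-abst h) T)
  Unfolds-term L h (bind abbr V T) =
    ↠-zeta (↠-trans₀
      (Unfolds-term (L ,[ abbr ] V) (Unfolds-abbr h (Unfolds-term L h V)) T)
      (↠-reflexive (sym (lift-emb _ ⟦ T ⟧⟨ L ,[ abbr ] V ⟩))))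
  Unfolds-term L h (cast U T)      = trans* (step* epsilon) (Unfolds-term L h T)

  Unfolds-var : ∀ L i → Unfolds L (var i)
  Unfolds-var ⋆              i = refl*
  Unfolds-var (L ,[ abst ] W) i = Unfolds-abst (Unfolds-var L) i
  Unfolds-var (L ,[ abbr ] V) i =
    Unfolds-abbr (Unfolds-var L) (Unfolds-term L (Unfolds-var L) V) i

  ↠-⟦⟧ : ∀ L T → Unfolds L T
  ↠-⟦⟧ L = Unfolds-term L (Unfolds-var L)

  ↠-sub : ∀ {σ θ θ′ L} → (∀ x → L ⊢ var (θ x) ↠⟨ 0 ⟩ emb θ′ (σ x)) →
          ∀ T → L ⊢ emb θ T ↠⟨ 0 ⟩ emb θ′ (sub σ T)
  ↠-sub h (srt s)   = refl*
  ↠-sub h (ref x)   = h x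
  ↠-sub h (apl V T) = ↠-app (↠-sub h V) (↠-sub h T)
  ↠-sub {σ} h (abs W T) =
    ↠-bind (↠-sub h W)
      (↠-sub (λ { zero → refl*
                ; (suc x) → ↠-trans₀ (↠-lift (h x)) (↠-reflexive (lift-emb-wk _ (σ x))) }) T)

  ⇒⇒↠ : ∀ {Γ T T′ L θ} → Γ ⊢ T ⇒ T′ → L ⊢ emb θ T ↠⟨ 0 ⟩ emb θ T′
  ⇒⇒↠ ⇒srt       = refl*
  ⇒⇒↠ ⇒ref       = refl*
  ⇒⇒↠ (⇒apl p q) = ↠-app (⇒⇒↠ p) (⇒⇒↠ q)
  ⇒⇒↠ (⇒abs p q) = ↠-bind (⇒⇒↠ p) (⇒⇒↠ q)
  ⇒⇒↠ {L = L} {θ} (⇒β {V′ = V′} {T′ = T′} p q _) =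
    trans* (↠-app (⇒⇒↠ p) (↠-bind refl* (⇒⇒↠ q)))
      -- The cast left by `beta` is dropped, δ unfolds the definition at each occurrence, and ζ
      -- removes it. Reading the contractum through `suc ∘ θ` exhibits it as a lifted term, as ζ
      -- demands.
      (trans* (step* beta) (trans* (step* (bindL epsilon))
        (↠-zeta (↠-trans₀ (↠-sub h T′) (↠-reflexive (sym (lift-emb θ (T′ [ V′ ]))))))))
    where
    h : ∀ x → L ,[ abbr ] emb θ V′ ⊢ var (⇑ᵣ θ x) ↠⟨ 0 ⟩ emb (suc ∘ θ) ((V′ ∷ₛ ref) x)
    h zero    = trans* (step* delta) (↠-reflexive (lift-emb θ V′))
    h (suc x) = refl*

  ⇒*⇒↠ : ∀ {Γ T T′ L θ} → Γ ⊢ T ⇒* T′ → L ⊢ emb θ T ↠⟨ 0 ⟩ emb θ T′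
  ⇒*⇒↠ []       = refl*
  ⇒*⇒↠ (p ∷ ps) = trans* (⇒⇒↠ p) (⇒*⇒↠ ps)

  -- A variable bound by an abstraction is admitted only if the type it is given is scoped,
  -- so that the entries of an environment which a valid term does not use are irrelevant.
  Scoped : (ℕ → Set) → Tm S → Set
  Scoped D (srt s)   = ⊤
  Scoped D (ref x)   = D x
  Scoped D (apl V T) = Scoped D V × Scoped D T
  Scoped D (abs W T) = Scoped D W × Scoped (Scoped D W ∷ₛ D) T

  Scoped-ren : ∀ {ρ D D′} → (∀ x → D x → D′ (ρ x)) → ∀ T → Scoped D T → Scoped D′ (ren ρ T)
  Scoped-ren h (srt s)   d       = tt
  Scoped-ren h (ref x)   d       = h x d
  Scoped-ren h (apl V T) (d , e) = Scoped-ren h V d , Scoped-ren h T e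
  Scoped-ren h (abs W T) (d , e) =
    Scoped-ren h W d , Scoped-ren (λ { zero → Scoped-ren h W ; (suc x) → h x }) T e

  ScopedCtx : (ℕ → Set) → Ctx → Set
  ScopedCtx D Γ = ∀ x → D x → Scoped D (Γ x)

  ScopedCtx-▷ : ∀ {D Γ} → ScopedCtx D Γ → ∀ W → ScopedCtx (Scoped D W ∷ₛ D) (Γ ▷ W)
  ScopedCtx-▷ h W zero    d = Scoped-ren (λ _ → id) W d
  ScopedCtx-▷ {Γ = Γ} h W (suc x) d = Scoped-ren (λ _ → id) (Γ x) (h x d)

  Scoped-tp : ∀ {D Γ} → ScopedCtx D Γ → ∀ T → Scoped D T → Scoped D (tp Γ T)
  Scoped-tp h (srt s)   d       = tt
  Scoped-tp h (ref x)   d       = h x d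
  Scoped-tp h (apl V T) (d , e) = d , Scoped-tp h T e
  Scoped-tp h (abs W T) (d , e) = d , Scoped-tp (ScopedCtx-▷ h W) T e

  -- `tp` alters only the leaf reached through functions and bodies, so one t-step at that leaf
  -- suffices, carried outwards by `appR` and `bindR`. Scopedness ensures that a variable there has
  -- such a step.
  ↠-tp : ∀ {D Γ L θ} → (∀ x → D x → L ⊢ var (θ x) ↠⟨ 1 ⟩ emb θ (Γ x)) →
         ∀ T → Scoped D T → L ⊢ emb θ T ↠⟨ 1 ⟩ emb θ (tp Γ T)
  ↠-tp h (srt s)   d       = step* sortS
  ↠-tp h (ref x)   d       = h x d
  ↠-tp h (apl V T) (d , e) = ↠-app refl* (↠-tp h T e)
  ↠-tp {Γ = Γ} {θ = θ} h (abs W T) (d , e) =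
    ↠-map bindR (↠-tp
      (λ { zero _     → ↠-trans₀ (step* ldelta) (↠-reflexive (lift-emb-wk θ W))
         ; (suc x) d′ → ↠-trans₀ (↠-lift (h x d′)) (↠-reflexive (lift-emb-wk θ (Γ x))) }) T e)

  dom : Env S → ℕ → Set
  dom ⋆              = λ _ → ⊥
  dom (L ,[ abst ] W) = Scoped (dom L) ⟦ W ⟧⟨ L ⟩ ∷ₛ dom L
  dom (L ,[ abbr ] V) = dom L

  ScopedCtx-⟦⟧ : ∀ L → ScopedCtx (dom L) ⟦ L ⟧ᶜ
  ScopedCtx-⟦⟧ ⋆ x ()
  ScopedCtx-⟦⟧ (L ,[ abst ] W) = ScopedCtx-▷ (ScopedCtx-⟦⟧ L) ⟦ W ⟧⟨ L ⟩
  ScopedCtx-⟦⟧ (L ,[ abbr ] V) = ScopedCtx-⟦⟧ L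

  ↠-ctx : ∀ L x → dom L x → L ⊢ var (pos L x) ↠⟨ 1 ⟩ ⌈ ⟦ L ⟧ᶜ x ⌉⟨ L ⟩
  ↠-ctx (L ,[ abst ] W) zero    d =
    ↠-trans₀ (trans* (step* ldelta) (↠-lift (↠-⟦⟧ L W)))
      (↠-reflexive (lift-emb-wk _ ⟦ W ⟧⟨ L ⟩))
  ↠-ctx (L ,[ abst ] W) (suc x) d =
    ↠-trans₀ (↠-lift (↠-ctx L x d)) (↠-reflexive (lift-emb-wk _ (⟦ L ⟧ᶜ x)))
  ↠-ctx (L ,[ abbr ] V) x       d =
    ↠-trans₀ (↠-lift (↠-ctx L x d)) (↠-reflexive (lift-emb _ (⟦ L ⟧ᶜ x)))

  -- Validity of a variable contains validity of the entry it refers to, which is what `dom` records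
  -- for abstractions.
  Valid⇒Scoped : ∀ {𝒜 L T} → Valid next 𝒜 L T → Scoped (dom L) ⟦ T ⟧⟨ L ⟩
  Valid⇒Scoped v-sort                    = tt
  Valid⇒Scoped (v-zero {b = abst} v)     = Valid⇒Scoped v
  Valid⇒Scoped (v-zero {b = abbr} v)     = Valid⇒Scoped v
  Valid⇒Scoped (v-lref {K} {abst} {i = i} v) = Scoped-ren (λ _ → id) (val K i) (Valid⇒Scoped v)
  Valid⇒Scoped (v-lref {b = abbr} v)     = Valid⇒Scoped v
  Valid⇒Scoped (v-bind {b = abst} v w)   = Valid⇒Scoped v , Valid⇒Scoped w
  Valid⇒Scoped (v-bind {b = abbr} v w)   = Valid⇒Scoped w
  Valid⇒Scoped (v-cast v w _)            = Valid⇒Scoped w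
  Valid⇒Scoped (v-app v w _)             = Valid⇒Scoped v , Valid⇒Scoped w

  ↠-tp^ : ∀ n L T → Scoped (dom L) T →
          Scoped (dom L) (tp^ n ⟦ L ⟧ᶜ T) × (L ⊢ ⌈ T ⌉⟨ L ⟩ ↠⟨ n ⟩ ⌈ tp^ n ⟦ L ⟧ᶜ T ⌉⟨ L ⟩)
  ↠-tp^ zero    L T d = d , refl*
  ↠-tp^ (suc n) L T d =
    let d′ , p = ↠-tp^ n L T d in
      Scoped-tp (ScopedCtx-⟦⟧ L) (tp^ n _ T) d′
    , subst (L ⊢ ⌈ T ⌉⟨ L ⟩ ↠⟨_⟩ ⌈ tp^ (suc n) ⟦ L ⟧ᶜ T ⌉⟨ L ⟩) (+-comm n 1)
        (trans* p (↠-tp (↠-ctx L) (tp^ n _ T) d′))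

  applicable-type : ∀ {𝒜 L T U U₀ V W T′ n} →
    Valid next 𝒜 L T → Valid next 𝒜 L U → L ⊢ T ↠⟨ 1 ⟩ U₀ → L ⊢ U ↠⟨ 0 ⟩ U₀ →
    L ⊢ T ↠⟨ n ⟩ lam W T′ → L ⊢ V ↠⟨ 1 ⟩ W →
    ∃ λ W₀ → ∃ λ U′ → (L ⊢ U ↠⟨ n ⟩ lam W₀ U′) × (L ⊢ V ↠⟨ 1 ⟩ W₀)
  applicable-type {L = L} {T} {U} {W = W} {T′} {n} t u p q r s
    with church-rosser c
    where
    -- `U` is convertible to the type of `T`, and `tp` commutes with `tp^ n`, which takes `T` to the
    -- abstraction.
    c : ⟦ L ⟧ᶜ ⊢ tp^ n ⟦ L ⟧ᶜ ⟦ U ⟧⟨ L ⟩ ≅ tp ⟦ L ⟧ᶜ ⟦ lam W T′ ⟧⟨ L ⟩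
    c = ≅trans (tp^-≅ n (≅trans (≅sym (proj₂ (preservation* (Valid⇒Good u) q)))
                                (proj₂ (preservation* (Valid⇒Good t) p))))
          (≅trans (≅reflexive (tp^-comm n 1))
            (≅sym (tp-≅ (proj₂ (preservation* (Valid⇒Good t) r)))))
  -- The type of `lam W T′` is an abstraction with the domain of `W`, so `X` is one over a reduct of
  -- that domain. `U` reaches `X` in the same `n` t-steps, hence the same element of `𝒜` serves; `V`
  -- follows `W` to the new domain.
  ... | X , ps , qs with abs-⇒* qs
  ... | _ , _ , refl , ws =
    _ , _
    , ↠-trans₀ (trans* (↠-⟦⟧ L U) (proj₂ (↠-tp^ n L _ (Valid⇒Scoped u)))) (⇒*⇒↠ ps)
    , ↠-trans₀ s (trans* (↠-⟦⟧ L W) (⇒*⇒↠ ws))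

  -- Induction on validity. Lifting and congruence carry the witnessing reductions of a subterm to
  -- the whole term; the application alone needs more, namely that `V` may be applied to the type of
  -- the function as well.
  Valid⇒Typed : ∀ {𝒜 L T} → Valid next 𝒜 L T → Σ (Term S) λ U → Typed next 𝒜 L T U
  Valid⇒Typed v-sort = _ , v-cast v-sort v-sort (_ , step* sortS , refl*)
  Valid⇒Typed (v-zero {b = abst} v) =
    _ , v-cast (Valid-lift v) (v-zero v) (_ , step* ldelta , refl*)
  Valid⇒Typed (v-zero {b = abbr} v) with Valid⇒Typed v
  ... | _ , v-cast u _ (_ , p , q) =
    _ , v-cast (Valid-lift u) (v-zero v) (_ , trans* (step* delta) (↠-lift p) , ↠-lift q)
  Valid⇒Typed (v-lref v) with Valid⇒Typed v
  ... | _ , v-cast u _ (_ , p , q) =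
    _ , v-cast (Valid-lift u) (v-lref v) (_ , ↠-lift p , ↠-lift q)
  Valid⇒Typed (v-bind v t) with Valid⇒Typed t
  ... | _ , v-cast u _ (_ , p , q) =
    _ , v-cast (v-bind v u) (v-bind v t) (_ , ↠-map bindR p , ↠-map bindR q)
  -- The annotation is itself the type, reached from the cast in one t-step.
  Valid⇒Typed (v-cast u t c) = _ , v-cast u (v-cast u t c) (_ , step* ee , refl*)
  Valid⇒Typed (v-app v t (n , a , W , T′ , r , s)) with Valid⇒Typed t
  ... | _ , v-cast u _ (_ , p , q) with applicable-type t u p q r s
  ... | W₀ , U′ , r′ , s′ =
    _ , v-cast (v-app v u (n , a , W₀ , U′ , r′ , s′)) (v-app v t (n , a , W , T′ , r , s))
          (_ , ↠-app refl* p , ↠-app refl* q)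

theorem5p4 : (S : Set) → DecidableEquality S → S → (next : S → S) →
    (𝒜 : ℕ → Set) (L : Env S) (T : Term S) →
    Valid next 𝒜 L T → Σ (Term S) λ U → Typed next 𝒜 L T U
theorem5p4 S _ _ next 𝒜 L T v = Simulation.Valid⇒Typed next v
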